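{- If $G$ is a $2$-connected partial $2$-tree that contains an $n$-vertex path, then $G$ contains an induced path of size $\frac{\log (n-3)}{2}$.
   Context: The class of $k$-trees is defined recursively: any clique on $k$ vertices is a $k$-tree; and if $G$ has a vertex $v$ whose neighborhood is a clique of size exactly $k$ and $G\setminus v$ is a $k$-tree, then $G$ is a $k$-tree. A partial $k$-tree is any subgraph of a $k$-tree. The size of a path is its number of vertices. Logarithms are base 2. -}

module Defs where

open import Data.Nat using (ℕ; zero; suc; _+_; _*_; _≤_; _<_)
open import Data.Fin using (Fin; toℕ; punchIn)
open import Data.Bool using (Bool; true; false)
open import Data.Product using (Σ; ∃; _×_; _,_)
open import Data.Sum using (_⊎_)
open import Relation.Binary.PropositionalEquality using (_≡_; _≢_)
open import Relation.Nullary using (¬_)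
open import Function.Definitions using (Injective)

record Graph (N : ℕ) : Set where
  field
    adj    : Fin N → Fin N → Bool
    sym    : ∀ u v → adj u v ≡ adj v u
    irrefl : ∀ v → adj v v ≡ false

open Graph public

_∶_~_ : ∀ {N} → Graph N → Fin N → Fin N → Set
G ∶ u ~ v = adj G u v ≡ true

delete : ∀ {N} → Graph (suc N) → Fin (suc N) → Graph N
delete G v = record
  { adj    = λ i j → adj G (punchIn v i) (punchIn v j)
  ; sym    = λ i j → sym G (punchIn v i) (punchIn v j)
  ; irrefl = λ i → irrefl G (punchIn v i)
  }

IsComplete : ∀ {N} → Graph N → Set
IsComplete {N} G = ∀ (u v : Fin N) → u ≢ v → G ∶ u ~ v

NbhdIsKClique : ∀ {N} → ℕ → Graph N → Fin N → Set
NbhdIsKClique {N} k G v =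
  Σ (Fin k → Fin N) λ f →
    Injective _≡_ _≡_ f
    × (∀ (u : Fin N) → (G ∶ v ~ u → ∃ λ i → f i ≡ u) × (∀ i → f i ≡ u → G ∶ v ~ u))
    × (∀ (i j : Fin k) → i ≢ j → G ∶ f i ~ f j)

data IsKTree (k : ℕ) : ∀ {N} → Graph N → Set where
  clique : (G : Graph k) → IsComplete G → IsKTree k G
  extend : ∀ {N} (G : Graph (suc N)) (v : Fin (suc N)) →
           NbhdIsKClique k G v → IsKTree k (delete G v) → IsKTree k G

IsSubgraphOf : ∀ {N M} → Graph N → Graph M → Set
IsSubgraphOf {N} {M} G H =
  Σ (Fin N → Fin M) λ f → Injective _≡_ _≡_ f × (∀ u v → G ∶ u ~ v → H ∶ f u ~ f v)

IsPartialKTree : ∀ {N} → ℕ → Graph N → Set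
IsPartialKTree {N} k G = Σ ℕ λ M → Σ (Graph M) λ H → IsKTree k H × IsSubgraphOf G H

data Reach {N} (G : Graph N) (u : Fin N) : Fin N → Set where
  here : Reach G u u
  step : ∀ {w x} → Reach G u w → G ∶ w ~ x → Reach G u x

IsConnected : ∀ {N} → Graph N → Set
IsConnected {N} G = ∀ (u w : Fin N) → Reach G u w

IsTwoConnected : ∀ {N} → Graph N → Set
IsTwoConnected {zero} G = 3 ≤ 0
IsTwoConnected {suc N} G =
  3 ≤ suc N × IsConnected G × (∀ (v : Fin (suc N)) → IsConnected (delete G v))

IsPath : ∀ {N s} → Graph N → (Fin s → Fin N) → Set
IsPath {N} {s} G p =
  Injective _≡_ _≡_ p × (∀ (i j : Fin s) → suc (toℕ i) ≡ toℕ j → G ∶ p i ~ p j)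

IsInducedPath : ∀ {N s} → Graph N → (Fin s → Fin N) → Set
IsInducedPath {N} {s} G p =
  IsPath G p ×
  (∀ (i j : Fin s) → G ∶ p i ~ p j → (suc (toℕ i) ≡ toℕ j ⊎ suc (toℕ j) ≡ toℕ i))

HasPathOfSize : ∀ {N} → Graph N → ℕ → Set
HasPathOfSize {N} G s = Σ (Fin s → Fin N) λ p → IsPath G p

HasInducedPathOfSize : ∀ {N} → Graph N → ℕ → Set
HasInducedPathOfSize {N} G s = Σ (Fin s → Fin N) λ p → IsInducedPath G p

{-# OPTIONS --safe #-}

-- A 2-tree has an elimination order: every vertex has at most two earlier
-- neighbours, and these are adjacent.  Such an order restricts to G.  For a
-- connected set C of vertices, all neighbours of C that precede C are
-- neighbours (in the 2-tree) of the first vertex of C, so there are at most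
-- two of them; 2-connectedness then makes it exactly two.
--
-- Let C be a component of the vertices of rank ≥ t, with outer neighbours u
-- and v, and let Q be a path inside C.  Removing the first vertex w of C leaves
-- a piece of Q of at least half the size in a component D of C − w.  D is
-- adjacent to w, hence its outer neighbours are {u , w} or {v , w}, say
-- {u , w}.  An induced path starting at u inside D + u can be kept, and one
-- starting at w inside D + w can be prolonged by an induced path from v to w
-- in C − D.  So whenever Q is halved, the total size of the two induced paths
-- grows by one.
module Submission where

open import Defs
open import Data.Bool using (true)
open import Data.Bool.Properties using () renaming (_≟_ to _≟ᵇ_)
open import Data.Empty using (⊥-elim)
open import Data.Fin using (Fin; zero; suc; toℕ; punchIn; punchOut; _≟_)
open import Data.Fin.Properties using (any?; toℕ-injective; toℕ<n; punchIn-punchOut; punchInᵢ≢i)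
open import Data.List using (List; []; _∷_; _++_; length; lookup; tabulate)
open import Data.List.Membership.Propositional using (_∉_)
open import Data.List.Membership.Propositional.Properties using (∈-lookup; ∈-∃++; ∈-++⁺ˡ; ∈-++⁺ʳ)
open import Data.List.Properties using (length-++; length-tabulate)
open import Data.List.Relation.Binary.Subset.Propositional using (_⊆_)
open import Data.List.Relation.Unary.All as All using (All; []; _∷_)
import Data.List.Relation.Unary.All.Properties as All
open import Data.List.Relation.Unary.AllPairs using ([]; _∷_)
open import Data.List.Relation.Unary.Any as Any using (Any; here; there)
open import Data.List.Relation.Unary.Linked as Linked using (Linked; []; [-]; _∷_)
open import Data.List.Relation.Unary.Unique.Propositional using (Unique)
open import Data.List.Relation.Unary.Unique.Propositional.Properties using (tabulate⁺)
open import Data.Nat using (ℕ; zero; suc; _+_; _≤_; _<_; _∸_; _^_; _*_; _⊔_; s≤s; _≤?_; _<?_) renaming (_≟_ to _≟ᴺ_)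
open import Data.Nat.Induction using (<-rec)
open import Data.Nat.Properties hiding (_≟_; _≤?_; _<?_)
open import Data.Nat.Tactic.RingSolver using (solve-∀)
open import Data.Product using (Σ; ∃; _×_; _,_; proj₁; proj₂)
open import Data.Sum using (_⊎_; inj₁; inj₂; [_,_]′)
open import Data.Unit using (⊤; tt)
open import Function using (_∘_; id)
open import Function.Definitions using (Injective)
open import Relation.Binary.PropositionalEquality as ≡ using (_≡_; _≢_; refl; cong; subst)
open import Relation.Nullary using (¬_; Dec; yes; no; contradiction)
open import Relation.Nullary.Decidable using (_×-dec_; _⊎-dec_; ¬?; map′)
open import Relation.Unary using (Pred; Decidable)
open import Level using (0ℓ)

-- Elimination orders

-- In the application `R` is adjacency in the ambient 2-tree, read on the vertices of `G`:
-- chordality would be lost on passing to the edges of `G` alone. Ranks may have gaps, so the order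
-- restricts to a subset by composing `rank` with the embedding.
record EliminationOrder {N} (R : Fin N → Fin N → Set) : Set where
  field
    bound          : ℕ
    rank           : Fin N → ℕ
    rank<bound     : ∀ x → rank x < bound
    rank-injective : ∀ {x y} → rank x ≡ rank y → x ≡ y
    chordal        : ∀ {a b c} → R a c → R b c → rank a < rank c → rank b < rank c →
                     a ≡ b ⊎ R a b
    width≤2        : ∀ {a b d c} → R a c → R b c → R d c →
                     rank a < rank c → rank b < rank c → rank d < rank c →
                     a ≡ b ⊎ a ≡ d ⊎ b ≡ d

pullback : ∀ {N M} {R : Fin M → Fin M → Set} (f : Fin N → Fin M) → Injective _≡_ _≡_ f →
           EliminationOrder R → EliminationOrder (λ x y → R (f x) (f y))
pullback f f-inj E = record
  { bound          = bound
  ; rank           = rank ∘ f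
  ; rank<bound     = rank<bound ∘ f
  ; rank-injective = f-inj ∘ rank-injective
  ; chordal        = λ p q r s → [ inj₁ ∘ f-inj , inj₂ ]′ (chordal p q r s)
  ; width≤2        = λ p q r s t u →
      [ inj₁ ∘ f-inj , [ inj₂ ∘ inj₁ ∘ f-inj , inj₂ ∘ inj₂ ∘ f-inj ]′ ]′ (width≤2 p q r s t u)
  }
  where open EliminationOrder E

Fin2-pigeonhole : (i j k : Fin 2) → i ≡ j ⊎ i ≡ k ⊎ j ≡ k
Fin2-pigeonhole zero       zero       _          = inj₁ refl
Fin2-pigeonhole zero       (suc zero) zero       = inj₂ (inj₁ refl)
Fin2-pigeonhole zero       (suc zero) (suc zero) = inj₂ (inj₂ refl)
Fin2-pigeonhole (suc zero) zero       zero       = inj₂ (inj₂ refl)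
Fin2-pigeonhole (suc zero) zero       (suc zero) = inj₂ (inj₁ refl)
Fin2-pigeonhole (suc zero) (suc zero) _          = inj₁ refl

private
  data PunchView {N} (v : Fin (suc N)) : Fin (suc N) → Set where
    hole  : PunchView v v
    punch : ∀ i → PunchView v (punchIn v i)

  punchView : ∀ {N} (v x : Fin (suc N)) → PunchView v x
  punchView v x with v ≟ x
  ... | yes refl = hole
  ... | no v≢x   = subst (PunchView v) (punchIn-punchOut v≢x) (punch (punchOut v≢x))

module _ {N} (H : Graph (suc N)) (v : Fin (suc N)) (nbhd : NbhdIsKClique 2 H v)
         (E : EliminationOrder (delete H v ∶_~_)) where
  private
    module E = EliminationOrder E

    rankOf : ∀ {x} → PunchView v x → ℕ
    rankOf hole      = E.bound
    rankOf (punch i) = E.rank i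

    R : Fin (suc N) → Fin (suc N) → Set
    R = H ∶_~_

    rankOf-injective : ∀ {x y} (p : PunchView v x) (q : PunchView v y) →
                       rankOf p ≡ rankOf q → x ≡ y
    rankOf-injective hole      hole      _  = refl
    rankOf-injective hole      (punch j) eq = contradiction (≡.sym eq) (<⇒≢ (E.rank<bound j))
    rankOf-injective (punch i) hole      eq = contradiction eq (<⇒≢ (E.rank<bound i))
    rankOf-injective (punch i) (punch j) eq = cong (punchIn v) (E.rank-injective eq)

    rankOf< : ∀ {x} (p : PunchView v x) → rankOf p < suc E.bound
    rankOf< hole      = ≤-refl
    rankOf< (punch i) = m≤n⇒m≤1+n (E.rank<bound i)

    late : ∀ {j} → ¬ (E.bound < E.rank j)
    late {j} = <-asym (E.rank<bound j)

    member : ∀ {x} → R x v → ∃ λ i → proj₁ nbhd i ≡ x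
    member {x} xv = proj₁ (proj₁ (proj₂ (proj₂ nbhd)) x) (≡.trans (sym H v x) xv)

    chordalOf : ∀ {a b c} (p : PunchView v a) (q : PunchView v b) (r : PunchView v c) →
                R a c → R b c → rankOf p < rankOf r → rankOf q < rankOf r → a ≡ b ⊎ R a b
    chordalOf p q hole ac bc _ _ with member ac | member bc
    ... | i , refl | j , refl with i ≟ j
    ...   | yes refl = inj₁ refl
    ...   | no i≢j   = inj₂ (proj₂ (proj₂ (proj₂ nbhd)) i j i≢j)
    chordalOf hole      _         (punch _) _  _  lt _  = ⊥-elim (late lt)
    chordalOf (punch _) hole      (punch _) _  _  _  lt = ⊥-elim (late lt)
    chordalOf (punch _) (punch _) (punch _) ac bc p  q  =
      [ inj₁ ∘ cong (punchIn v) , inj₂ ]′ (E.chordal ac bc p q)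

    width≤2Of : ∀ {a b d c} (p : PunchView v a) (q : PunchView v b) (s : PunchView v d)
                (r : PunchView v c) → R a c → R b c → R d c →
                rankOf p < rankOf r → rankOf q < rankOf r → rankOf s < rankOf r →
                a ≡ b ⊎ a ≡ d ⊎ b ≡ d
    width≤2Of p q s hole ac bc dc _ _ _ with member ac | member bc | member dc
    ... | i , refl | j , refl | k , refl with Fin2-pigeonhole i j k
    ...   | inj₁ eq        = inj₁ (cong (proj₁ nbhd) eq)
    ...   | inj₂ (inj₁ eq) = inj₂ (inj₁ (cong (proj₁ nbhd) eq))
    ...   | inj₂ (inj₂ eq) = inj₂ (inj₂ (cong (proj₁ nbhd) eq))
    width≤2Of hole _ _ (punch _) _ _ _ lt _ _ = ⊥-elim (late lt)
    width≤2Of (punch _) hole _ (punch _) _ _ _ _ lt _ = ⊥-elim (late lt)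
    width≤2Of (punch _) (punch _) hole (punch _) _ _ _ _ _ lt = ⊥-elim (late lt)
    width≤2Of (punch _) (punch _) (punch _) (punch _) ac bc dc p q s
      with E.width≤2 ac bc dc p q s
    ... | inj₁ eq        = inj₁ (cong (punchIn v) eq)
    ... | inj₂ (inj₁ eq) = inj₂ (inj₁ (cong (punchIn v) eq))
    ... | inj₂ (inj₂ eq) = inj₂ (inj₂ (cong (punchIn v) eq))

  -- The vertex `v` is put last. Its earlier neighbours are then its whole neighbourhood, a
  -- 2-clique, and it is an earlier neighbour of no vertex, so all other conditions come from `E`.
  extendOrder : EliminationOrder R
  extendOrder = record
    { bound          = suc E.bound
    ; rank           = rankOf ∘ punchView v
    ; rank<bound     = rankOf< ∘ punchView v
    ; rank-injective = λ {x} {y} → rankOf-injective (punchView v x) (punchView v y)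
    ; chordal        = λ {a} {b} {c} → chordalOf (punchView v a) (punchView v b) (punchView v c)
    ; width≤2        = λ {a} {b} {d} {c} →
        width≤2Of (punchView v a) (punchView v b) (punchView v d) (punchView v c)
    }

eliminationOrder : ∀ {N} {H : Graph N} → IsKTree 2 H → EliminationOrder (H ∶_~_)
eliminationOrder (clique H _) = record
  { bound          = 2
  ; rank           = toℕ
  ; rank<bound     = toℕ<n
  ; rank-injective = toℕ-injective
  ; chordal        = λ { {zero} {zero} _ _ _ _ → inj₁ refl
                       ; {suc zero} {_} {suc zero} _ _ (s≤s ()) _
                       ; {_} {suc zero} {suc zero} _ _ _ (s≤s ()) }
  ; width≤2        = λ {a} {b} {d} _ _ _ _ _ _ → Fin2-pigeonhole a b d
  }
eliminationOrder (extend H v nbhd t) = extendOrder H v nbhd (eliminationOrder t)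

-- Paths as lists

module _ {A : Set} where

  Linked-++⁻ˡ : ∀ {R : A → A → Set} xs {ys} → Linked R (xs ++ ys) → Linked R xs
  Linked-++⁻ˡ []           _        = []
  Linked-++⁻ˡ (x ∷ [])     _        = [-]
  Linked-++⁻ˡ (x ∷ y ∷ xs) (r ∷ rs) = r ∷ Linked-++⁻ˡ (y ∷ xs) rs

  Linked-++⁻ʳ : ∀ {R : A → A → Set} xs {ys} → Linked R (xs ++ ys) → Linked R ys
  Linked-++⁻ʳ []       rs = rs
  Linked-++⁻ʳ (x ∷ xs) rs = Linked-++⁻ʳ xs (Linked.tail rs)

  Unique-++⁻ˡ : ∀ xs {ys : List A} → Unique (xs ++ ys) → Unique xs
  Unique-++⁻ˡ []       _        = []
  Unique-++⁻ˡ (x ∷ xs) (p ∷ ps) = All.++⁻ˡ xs p ∷ Unique-++⁻ˡ xs ps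

  Unique-++⁻ʳ : ∀ xs {ys : List A} → Unique (xs ++ ys) → Unique ys
  Unique-++⁻ʳ []       ps       = ps
  Unique-++⁻ʳ (x ∷ xs) (_ ∷ ps) = Unique-++⁻ʳ xs ps

  Unique-separator∉ˡ : ∀ xs {w : A} {ys} → Unique (xs ++ w ∷ ys) → w ∉ xs
  Unique-separator∉ˡ (x ∷ xs) (p ∷ ps) (here refl) = All.lookup p (∈-++⁺ʳ xs (here refl)) refl
  Unique-separator∉ˡ (x ∷ xs) (p ∷ ps) (there w∈)  = Unique-separator∉ˡ xs ps w∈

  Unique-separator∉ʳ : ∀ xs {w : A} {ys} → Unique (xs ++ w ∷ ys) → w ∉ ys
  Unique-separator∉ʳ xs ps w∈ with Unique-++⁻ʳ xs ps
  ... | w≢ ∷ _ = All.lookup w≢ w∈ refl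

module _ {N} (R : Fin N → Fin N → Set) where

  HalfWithout : Fin N → List (Fin N) → Set
  HalfWithout w Q = Σ (List (Fin N)) λ Q′ →
    Linked R Q′ × Unique Q′ × w ∉ Q′ × Q′ ⊆ Q × length Q ≤ suc (2 * length Q′)

  -- If `w` lies on the path, it splits the rest into two sides, and the longer one is kept.
  halfWithout : ∀ w Q → Linked R Q → Unique Q → HalfWithout w Q
  halfWithout w Q lQ uQ with Any.any? (w ≟_) Q
  ... | no w∉Q = Q , lQ , uQ , w∉Q , id , m≤n⇒m≤1+n (m≤m+n _ _)
  ... | yes w∈Q with ∈-∃++ w∈Q
  ...   | xs , ys , refl with ≤-total (length xs) (length ys)
  ...     | inj₁ xs≤ys =
    ys , Linked.tail (Linked-++⁻ʳ xs lQ) , Unique-++⁻ʳ (w ∷ []) (Unique-++⁻ʳ xs uQ) ,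
    Unique-separator∉ʳ xs uQ , ∈-++⁺ʳ xs ∘ there , size
    where
    size : length (xs ++ w ∷ ys) ≤ suc (2 * length ys)
    size rewrite length-++ xs {w ∷ ys} | +-suc (length xs) (length ys) | +-identityʳ (length ys) =
      s≤s (+-monoˡ-≤ (length ys) xs≤ys)
  ...     | inj₂ ys≤xs =
    xs , Linked-++⁻ˡ xs lQ , Unique-++⁻ˡ xs uQ ,
    Unique-separator∉ˡ xs uQ , ∈-++⁺ˡ , size
    where
    size : length (xs ++ w ∷ ys) ≤ suc (2 * length xs)
    size rewrite length-++ xs {w ∷ ys} | +-suc (length xs) (length ys) | +-identityʳ (length xs) =
      s≤s (+-monoʳ-≤ (length xs) ys≤xs)

tabulate-linked : ∀ {A : Set} {R : A → A → Set} {n} (p : Fin n → A) →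
                  (∀ i j → suc (toℕ i) ≡ toℕ j → R (p i) (p j)) → Linked R (tabulate p)
tabulate-linked {n = zero}        p e = []
tabulate-linked {n = suc zero}    p e = [-]
tabulate-linked {n = suc (suc n)} p e =
  e zero (suc zero) refl ∷ tabulate-linked (p ∘ suc) (λ i j eq → e (suc i) (suc j) (cong suc eq))

-- Induced paths

module InducedPaths {N} (G : Graph N) where

  V : Set
  V = Fin N

  infix 4 _~_ _~?_

  _~_ : V → V → Set
  x ~ y = G ∶ x ~ y

  _~?_ : ∀ x y → Dec (x ~ y)
  x ~? y = adj G x y ≟ᵇ true

  ~-sym : ∀ {x y} → x ~ y → y ~ x
  ~-sym {x} {y} e = ≡.trans (sym G y x) e

  ~⇒≢ : ∀ {x y} → x ~ y → x ≢ y
  ~⇒≢ {x} e refl with ≡.trans (≡.sym e) (irrefl G x)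
  ... | ()

  -- Equality is included so that not touching excludes repeated vertices and chords at once.
  Touch : V → V → Set
  Touch x y = x ≡ y ⊎ x ~ y

  touch? : ∀ x y → Dec (Touch x y)
  touch? x y = (x ≟ y) ⊎-dec (x ~? y)

  data Induced : List V → Set where
    [-]   : ∀ {x} → Induced (x ∷ [])
    _∷⟨_⟩_ : ∀ {x y l} → x ~ y → All (¬_ ∘ Touch x) l → Induced (y ∷ l) → Induced (x ∷ y ∷ l)

  All-lookup : ∀ {P : V → Set} {l} → All P l → ∀ i → P (lookup l i)
  All-lookup {l = l} ps i = All.lookup ps (∈-lookup {xs = l} i)

  Induced⇒injective : ∀ {l} → Induced l → Injective _≡_ _≡_ (lookup l)
  Induced⇒injective {_ ∷ _} _ {zero} {zero} _ = refl
  Induced⇒injective (e ∷⟨ _ ⟩ _)  {zero}        {suc zero}    eq = contradiction eq (~⇒≢ e)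
  Induced⇒injective (_ ∷⟨ ps ⟩ _) {zero}        {suc (suc j)} eq = contradiction (inj₁ eq) (All-lookup ps j)
  Induced⇒injective (e ∷⟨ _ ⟩ _)  {suc zero}    {zero}        eq = contradiction (≡.sym eq) (~⇒≢ e)
  Induced⇒injective (_ ∷⟨ ps ⟩ _) {suc (suc i)} {zero}        eq =
    contradiction (inj₁ (≡.sym eq)) (All-lookup ps i)
  Induced⇒injective (_ ∷⟨ _ ⟩ ind) {suc i} {suc j} eq = cong suc (Induced⇒injective ind eq)

  Induced⇒edges : ∀ {l} → Induced l → ∀ i j → suc (toℕ i) ≡ toℕ j → lookup l i ~ lookup l j
  Induced⇒edges (e ∷⟨ _ ⟩ _)   zero    (suc zero) _  = e
  Induced⇒edges (_ ∷⟨ _ ⟩ ind) (suc i) (suc j)    eq = Induced⇒edges ind i j (suc-injective eq)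
  Induced⇒edges [-] zero zero ()

  Induced⇒noChords : ∀ {l} → Induced l → ∀ i j → lookup l i ~ lookup l j →
                     suc (toℕ i) ≡ toℕ j ⊎ suc (toℕ j) ≡ toℕ i
  Induced⇒noChords {_ ∷ _} _ zero zero e = contradiction refl (~⇒≢ e)
  Induced⇒noChords (_ ∷⟨ _ ⟩ _)  zero          (suc zero)    _ = inj₁ refl
  Induced⇒noChords (_ ∷⟨ ps ⟩ _) zero          (suc (suc j)) e = contradiction (inj₂ e) (All-lookup ps j)
  Induced⇒noChords (_ ∷⟨ _ ⟩ _)  (suc zero)    zero          _ = inj₂ refl
  Induced⇒noChords (_ ∷⟨ ps ⟩ _) (suc (suc i)) zero          e =
    contradiction (inj₂ (~-sym e)) (All-lookup ps i)
  Induced⇒noChords (_ ∷⟨ _ ⟩ ind) (suc i) (suc j) e =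
    [ inj₁ ∘ cong suc , inj₂ ∘ cong suc ]′ (Induced⇒noChords ind i j e)

  Induced⇒HasInducedPath : ∀ {l} → Induced l → HasInducedPathOfSize G (length l)
  Induced⇒HasInducedPath {l} ind =
    lookup l , (Induced⇒injective ind , Induced⇒edges ind) , Induced⇒noChords ind

  Induced-tail : ∀ {x y l} → Induced (x ∷ y ∷ l) → Induced (y ∷ l)
  Induced-tail (_ ∷⟨ _ ⟩ ind) = ind

  -- Cutting at the last vertex of A ++ [ w ] touched by z keeps the path induced.
  prepend : ∀ z A w l → z ≢ w → All (¬_ ∘ Touch z) l → Any (Touch z) (A ++ w ∷ []) →
            Induced (A ++ w ∷ l) → Σ (List V) λ A′ → Induced (z ∷ A′ ++ w ∷ l) × A′ ⊆ A
  prepend z [] w l z≢w far (here (inj₁ z≡w)) ind = contradiction z≡w z≢w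
  prepend z [] w l z≢w far (here (inj₂ z~w)) ind = [] , z~w ∷⟨ far ⟩ ind , id
  prepend z (a ∷ A) w l z≢w far touch ind with Any.any? (touch? z) (A ++ w ∷ [])
  ... | yes later with prepend z A w l z≢w far later (tail′ A ind)
    where
    tail′ : ∀ A → Induced (a ∷ A ++ w ∷ l) → Induced (A ++ w ∷ l)
    tail′ []      = Induced-tail
    tail′ (_ ∷ _) = Induced-tail
  ...   | A′ , ind′ , A′⊆A = A′ , ind′ , there ∘ A′⊆A
  prepend z (a ∷ A) w l z≢w far (there later) ind | no none = contradiction later none
  prepend z (a ∷ A) w l z≢w far (here (inj₁ refl)) ind | no none = A , ind , there
  prepend z (a ∷ A) w l z≢w far (here (inj₂ z~a)) ind | no none =
    a ∷ A , z~a ∷⟨ All.++⁺ (All.++⁻ˡ A rest) (All.head (All.++⁻ʳ A rest) ∷ far) ⟩ ind , id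
    where rest = All.¬Any⇒All¬ (A ++ w ∷ []) none

-- Components of upper rank sets

module Components {N} (G : Graph N) {R : Fin N → Fin N → Set}
  (R-sym : ∀ {x y} → R x y → R y x) (G⊆R : ∀ {x y} → G ∶ x ~ y → R x y)
  (E : EliminationOrder R)
  -- 2-connectedness in closure form: a set containing `a` and closed under edges that do not lead
  -- to `w` contains every `b` other than `w`. Components can be used as `S` directly, without walks
  -- in a vertex-deleted graph.
  (unseparated : ∀ w {a b} → a ≢ w → b ≢ w → (S : Fin N → Set) →
                 (∀ {x y} → S x → G ∶ x ~ y → y ≢ w → S y) → S a → S b)
  where

  open EliminationOrder E
  open InducedPaths G

  -- A component of the vertices of rank at least `t` is represented by one of its vertices `c`, as
  -- the predicate `Conn t c`. The rank condition in `start` keeps vertices of smaller rank from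
  -- forming components of their own.
  data Conn (t : ℕ) (a : V) : V → Set where
    start : t ≤ rank a → Conn t a a
    _▻⟨_⟩_ : ∀ {x y} → Conn t a x → x ~ y → t ≤ rank y → Conn t a y

  module _ {t : ℕ} where

    conn-rank : ∀ {a b} → Conn t a b → t ≤ rank b
    conn-rank (start r)     = r
    conn-rank (_ ▻⟨ _ ⟩ r) = r

    conn-trans : ∀ {a b c} → Conn t a b → Conn t b c → Conn t a c
    conn-trans p (start _)     = p
    conn-trans p (q ▻⟨ e ⟩ r) = conn-trans p q ▻⟨ e ⟩ r

    conn-sym : ∀ {a b} → Conn t a b → Conn t b a
    conn-sym (start r)     = start r
    conn-sym (p ▻⟨ e ⟩ r) = conn-trans (start r ▻⟨ ~-sym e ⟩ conn-rank p) (conn-sym p)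

  conn-mono : ∀ {s t a b} → t ≤ s → Conn s a b → Conn t a b
  conn-mono t≤s (start r)     = start (≤-trans t≤s r)
  conn-mono t≤s (p ▻⟨ e ⟩ r) = conn-mono t≤s p ▻⟨ e ⟩ ≤-trans t≤s r

  -- Floyd–Warshall: lowering the threshold by one admits at most one new vertex x.
  module _ {t : ℕ} (connected? : ∀ a b → Dec (Conn (suc t) a b)) where

    private
      Meets : V → V → Set
      Meets x a = a ≡ x ⊎ ∃ λ c → Conn (suc t) a c × c ~ x

      meets? : ∀ x a → Dec (Meets x a)
      meets? x a = (a ≟ x) ⊎-dec any? (λ c → connected? a c ×-dec (c ~? x))

      meets⇒conn : ∀ {x a} → rank x ≡ t → Meets x a → Conn t a x
      meets⇒conn rx (inj₁ refl)        = start (≤-reflexive (≡.sym rx))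
      meets⇒conn rx (inj₂ (c , p , e)) = conn-mono (n≤1+n _) p ▻⟨ e ⟩ ≤-reflexive (≡.sym rx)

      rise : ∀ {y} → t ≤ rank y → rank y ≢ t → suc t ≤ rank y
      rise r ne = ≤∧≢⇒< r (ne ∘ ≡.sym)

      Split : V → V → V → Set
      Split x a b = Conn (suc t) a b ⊎ (Meets x a × Meets x b)

      -- A walk that visits `x` is remembered only by how each of its ends reaches `x` through
      -- vertices above the old threshold.
      split : ∀ {x a b} → rank x ≡ t → Conn t a b → Split x a b
      split {x} {a} rx (start r) with a ≟ x
      ... | yes a≡x = inj₂ (inj₁ a≡x , inj₁ a≡x)
      ... | no a≢x  = inj₁ (start (rise r λ ra → a≢x (rank-injective (≡.trans ra (≡.sym rx)))))
      split {x} rx (_▻⟨_⟩_ {_} {y} p e r) with y ≟ x | split rx p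
      ... | yes refl | inj₁ q       = inj₂ (inj₂ (_ , q , e) , inj₁ refl)
      ... | yes refl | inj₂ (m , _) = inj₂ (m , inj₁ refl)
      ... | no y≢x   | s            = extend′ s
        where
        ry = rise r λ ry → y≢x (rank-injective (≡.trans ry (≡.sym rx)))
        extend′ : Split x _ _ → Split x _ y
        extend′ (inj₁ q)                         = inj₁ (q ▻⟨ e ⟩ ry)
        extend′ (inj₂ (m , inj₁ refl))           = inj₂ (m , inj₂ (_ , start ry , ~-sym e))
        extend′ (inj₂ (m , inj₂ (c , q , c~x))) =
          inj₂ (m , inj₂ (c , conn-trans (start ry ▻⟨ ~-sym e ⟩ conn-rank (conn-sym q)) q , c~x))

      lift : (∀ y → rank y ≢ t) → ∀ {a b} → Conn t a b → Conn (suc t) a b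
      lift none (start r)     = start (rise r (none _))
      lift none (p ▻⟨ e ⟩ r) = lift none p ▻⟨ e ⟩ rise r (none _)

    connected?-step : ∀ a b → Dec (Conn t a b)
    connected?-step a b with any? (λ x → rank x ≟ᴺ t)
    ... | no none = map′ (conn-mono (n≤1+n _)) (lift (λ y ry → none (y , ry))) (connected? a b)
    ... | yes (x , rx) =
      map′ [ conn-mono (n≤1+n _) , (λ (ma , mb) → conn-trans (meets⇒conn rx ma) (conn-sym (meets⇒conn rx mb))) ]′
           (split rx)
           (connected? a b ⊎-dec (meets? x a ×-dec meets? x b))

  connected? : ∀ t a b → Dec (Conn t a b)
  connected? t = go (bound ∸ t) t (m≤n+m∸n bound t)
    where
    go : ∀ k t → bound ≤ t + k → ∀ a b → Dec (Conn t a b)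
    -- At `bound` and beyond there are no vertices left, so nothing is connected.
    go zero t le a b = no λ p →
      <⇒≱ (rank<bound b) (≤-trans le (≤-trans (≤-reflexive (+-identityʳ t)) (conn-rank p)))
    go (suc k) t le = connected?-step (go k (suc t) (≤-trans le (≤-reflexive (+-suc t k))))

  -- First vertices, descending walks and outer neighbours

  minimal : ∀ {P : Pred V 0ℓ} → Decidable P → ∀ a → P a →
            ∃ λ x → P x × ∀ y → P y → rank x ≤ rank y
  minimal {P} P? a pa = <-rec Goal go (rank a) a refl pa
    where
    Goal : ℕ → Set
    Goal n = ∀ a → rank a ≡ n → P a → ∃ λ x → P x × ∀ y → P y → rank x ≤ rank y
    go : ∀ n → (∀ {m} → m < n → Goal m) → Goal n
    go n rec a refl pa with any? (λ y → P? y ×-dec (rank y <? rank a))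
    ... | yes (y , py , lt) = rec lt y refl py
    ... | no none           = a , pa , λ y py → ≮⇒≥ λ lt → none (y , py , lt)

  -- A walk in `R` from `c` to `x` along which the rank falls at every step. Chordality transports a
  -- neighbour that is earlier than `x` down such a walk.
  data Descent (x : V) : V → Set where
    done : Descent x x
    down : ∀ {c d} → R d c → rank d < rank c → rank x ≤ rank d → Descent x d → Descent x c

  -- If `d` precedes `c`, the edge extends the descent. Otherwise `c` and the next vertex `d′` of
  -- the descent are both earlier neighbours of `d`, hence equal or adjacent by chordality, so `d`
  -- is bypassed and the remaining descent is shorter.
  descent-edge : ∀ {x c d} → rank x ≤ rank c → c ≢ d → R c d → Descent x d → Descent x c
  descent-edge {x} {c} {d} x≤c c≢d cd desc with rank d <? rank c
  descent-edge x≤c c≢d cd done | yes d<c = down (R-sym cd) d<c ≤-refl done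
  descent-edge x≤c c≢d cd desc@(down _ d′<d x≤d′ _) | yes d<c =
    down (R-sym cd) d<c (≤-trans x≤d′ (<⇒≤ d′<d)) desc
  descent-edge x≤c c≢d cd done | no d≮c = contradiction (rank-injective (≤-antisym (≮⇒≥ d≮c) x≤c)) c≢d
  descent-edge {c = c} x≤c c≢d cd (down {d = d′} d′d d′<d x≤d′ desc) | no d≮c
    with chordal cd d′d (≤∧≢⇒< (≮⇒≥ d≮c) (c≢d ∘ rank-injective)) d′<d
  ... | inj₁ refl = desc
  ... | inj₂ cd′ with c ≟ d′
  ...   | yes refl = desc
  ...   | no c≢d′  = descent-edge x≤c c≢d′ cd′ desc

  -- Both `y` and the next vertex `d` are earlier neighbours of `c`. They differ because `y`
  -- precedes `x` while `d` does not, so chordality makes them adjacent, and the argument repeats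
  -- from `d`.
  earlier-neighbour : ∀ {x y c} → rank y < rank x → R y c → Descent x c → R y x
  earlier-neighbour y<x yc done = yc
  earlier-neighbour y<x yc (down dc d<c x≤d desc)
    with chordal yc dc (<-trans (<-≤-trans y<x x≤d) d<c) d<c
  ... | inj₁ refl = contradiction x≤d (<⇒≱ y<x)
  ... | inj₂ yd   = earlier-neighbour y<x yd desc

  conn⇒descent : ∀ {t x} → (∀ y → Conn t x y → rank x ≤ rank y) → ∀ {z} → Conn t x z → Descent x z
  conn⇒descent min (start _) = done
  conn⇒descent min p@(q ▻⟨ e ⟩ _) =
    descent-edge (min _ p) (~⇒≢ (~-sym e)) (R-sym (G⊆R e)) (conn⇒descent min q)

  Adjacent : ℕ → V → V → Set
  Adjacent t c y = ∃ λ x → Conn t c x × x ~ y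

  adjacent? : ∀ t c y → Dec (Adjacent t c y)
  adjacent? t c y = any? (λ x → connected? t c x ×-dec (x ~? y))

  -- Descending from each point of attachment to the first vertex `x` of the component turns the
  -- three outer vertices into earlier neighbours of `x`, where the width bound applies.
  two-outer-neighbours : ∀ {t c a b d} → t ≤ rank c → rank a < t → rank b < t → rank d < t →
    Adjacent t c a → Adjacent t c b → Adjacent t c d → a ≡ b ⊎ a ≡ d ⊎ b ≡ d
  two-outer-neighbours {t} {c} t≤c ra rb rd Na Nb Nd with minimal (connected? t c) c (start t≤c)
  ... | x , cx , min = width≤2 (edge ra Na) (edge rb Nb) (edge rd Nd) (below ra) (below rb) (below rd)
    where
    below : ∀ {y} → rank y < t → rank y < rank x
    below ry = <-≤-trans ry (conn-rank cx)
    edge : ∀ {y} → rank y < t → Adjacent t c y → R y x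
    edge ry (z , cz , e) = earlier-neighbour (below ry) (G⊆R (~-sym e))
      (conn⇒descent (λ y p → min y (conn-trans cx p)) (conn-trans (conn-sym cx) cz))

  -- Components with two outer neighbours, and their pairs of induced paths

  record Attached (t : ℕ) (u v c : V) : Set where
    field
      u≢v   : u ≢ v
      u<t   : rank u < t
      v<t   : rank v < t
      t≤c   : t ≤ rank c
      -- Only an inclusion is recorded; that `u` and `v` both are neighbours is a consequence of
      -- 2-connectedness.
      outer : ∀ {x y} → Conn t c x → x ~ y → rank y < t → y ≡ u ⊎ y ≡ v

  attached-sym : ∀ {t u v c} → Attached t u v c → Attached t v u c
  attached-sym s = record
    { u≢v = u≢v ∘ ≡.sym ; u<t = v<t ; v<t = u<t ; t≤c = t≤c
    ; outer = λ p e lt → [ inj₂ , inj₁ ]′ (outer p e lt) }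
    where open Attached s

  -- Without an edge to `u`, the component could be left only through `v`, so `v` would separate `c`
  -- from `u`.
  attached⇒adjacent : ∀ {t u v c} → Attached t u v c → Adjacent t c u
  attached⇒adjacent {t} {u} {v} {c} s with adjacent? t c u
  ... | yes a = a
  ... | no ¬a = contradiction (conn-rank (unseparated v c≢v u≢v (Conn t c) closed (start t≤c))) (<⇒≱ u<t)
    where
    open Attached s
    c≢v : c ≢ v
    c≢v refl = <⇒≱ v<t t≤c
    closed : ∀ {x y} → Conn t c x → x ~ y → y ≢ v → Conn t c y
    closed {x} {y} p e y≢v with t ≤? rank y
    ... | yes r = p ▻⟨ e ⟩ r
    ... | no r with outer p e (≰⇒> r)
    ...   | inj₁ refl = contradiction (x , p , e) ¬a
    ...   | inj₂ y≡v  = contradiction y≡v y≢v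

  record TwoPaths (t : ℕ) (u v c : V) (m : ℕ) : Set where
    field
      l₁ l₂    : List V
      induced₁ : Induced (u ∷ l₁)
      induced₂ : Induced (v ∷ l₂)
      inside₁  : All (Conn t c) l₁
      inside₂  : All (Conn t c) l₂
      -- The ends `u` and `v` are not counted. With `suc m` instead of `m`, the halving bound
      -- `m ≤ suc (2 * m′)` becomes exact doubling. The leading factor 2 is what one vertex in each
      -- list affords when `m` is 1.
      size     : 2 * suc m ≤ 2 ^ (length l₁ + length l₂)

  twoPaths-sym : ∀ {t u v c m} → TwoPaths t u v c m → TwoPaths t v u c m
  twoPaths-sym {m = m} r = record
    { induced₁ = induced₂ ; induced₂ = induced₁ ; inside₁ = inside₂ ; inside₂ = inside₁
    ; size = subst (λ k → 2 * suc m ≤ 2 ^ k) (+-comm (length l₁) (length l₂)) size }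
    where open TwoPaths r

  -- One neighbour of `u` and one of `v` inside the component suffice; they may coincide, since the
  -- two paths need not be disjoint.
  twoPaths-base : ∀ {t u v c m} → Attached t u v c → m ≤ 1 → TwoPaths t u v c m
  twoPaths-base s m≤1 with attached⇒adjacent s | attached⇒adjacent (attached-sym s)
  ... | x , cx , x~u | y , cy , y~v = record
    { l₁ = x ∷ [] ; l₂ = y ∷ []
    ; induced₁ = ~-sym x~u ∷⟨ [] ⟩ [-] ; induced₂ = ~-sym y~v ∷⟨ [] ⟩ [-]
    ; inside₁ = cx ∷ [] ; inside₂ = cy ∷ []
    ; size = *-monoʳ-≤ 2 (s≤s m≤1) }

  -- Passing to a component after removal of the first vertex

  module Descend {t : ℕ} {u v c w d : V} (s : Attached t u v c)
    (cw : Conn t c w) (w-min : ∀ y → Conn t c y → rank w ≤ rank y)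
    (cd : Conn t c d) (d≢w : d ≢ w) where

    open Attached s

    -- Since `w` is first in its component and ranks are injective, the other vertices of the
    -- component are exactly those of rank at least `t′`.
    t′ : ℕ
    t′ = suc (rank w)

    t≤w : t ≤ rank w
    t≤w = conn-rank cw

    above : ∀ {y} → Conn t c y → y ≢ w → t′ ≤ rank y
    above cy y≢w = ≤∧≢⇒< (w-min _ cy) (y≢w ∘ ≡.sym ∘ rank-injective)

    D : V → Set
    D = Conn t′ d

    D⊆C : ∀ {x} → D x → Conn t c x
    D⊆C p = conn-trans cd (conn-mono (m≤n⇒m≤1+n t≤w) p)

    dD : D d
    dD = start (above cd d≢w)

    D-absorbs : ∀ {x y} → t ≤ rank y → y ≢ w → D x → x ~ y → D y
    D-absorbs r y≢w dx e = dx ▻⟨ e ⟩ above (D⊆C dx ▻⟨ e ⟩ r) y≢w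

    D-outer : ∀ {x y} → D x → x ~ y → rank y < t′ → y ≡ w ⊎ y ≡ u ⊎ y ≡ v
    D-outer {x} {y} dx e lt with t ≤? rank y | y ≟ w
    ... | _     | yes y≡w = inj₁ y≡w
    ... | yes r | no y≢w  = contradiction (conn-rank (D-absorbs r y≢w dx e)) (<⇒≱ lt)
    ... | no r  | no _    = inj₂ (outer (D⊆C dx) e (≰⇒> r))

    -- A walk from `d` to `w` in the larger component stays in `D` until the step at which it first
    -- enters `w`.
    D-adjacent-w : Adjacent t′ d w
    D-adjacent-w with reaches (conn-trans (conn-sym cd) cw)
      where
      reaches : ∀ {x} → Conn t d x → D x ⊎ Adjacent t′ d w
      reaches (start _) = inj₁ dD
      reaches (_▻⟨_⟩_ {_} {y} p e r) with reaches p
      ... | inj₂ a  = inj₂ a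
      ... | inj₁ dx with y ≟ w
      ...   | yes refl = inj₂ (_ , dx , e)
      ...   | no y≢w   = inj₁ (D-absorbs r y≢w dx e)
    ... | inj₁ dw = contradiction (conn-rank dw) 1+n≰n
    ... | inj₂ a  = a

    -- Together with `w` these would be three distinct outer neighbours of `D`.
    ¬D-adjacent-both : ¬ (Adjacent t′ d u × Adjacent t′ d v)
    ¬D-adjacent-both (au , av)
      with two-outer-neighbours (conn-rank dD) (weaken u<t) (weaken v<t) ≤-refl au av D-adjacent-w
      where
      weaken : ∀ {y} → rank y < t → rank y < t′
      weaken lt = <-trans (<-≤-trans lt t≤w) ≤-refl
    ... | inj₁ u≡v         = u≢v u≡v
    ... | inj₂ (inj₁ refl) = <⇒≱ u<t t≤w
    ... | inj₂ (inj₂ refl) = <⇒≱ v<t t≤w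

    D-attached : ¬ Adjacent t′ d v → Attached t′ u w d
    D-attached ¬av = record
      { u≢v = λ { refl → <⇒≱ u<t t≤w }
      ; u<t = <-trans (<-≤-trans u<t t≤w) ≤-refl
      ; v<t = ≤-refl
      ; t≤c = conn-rank dD
      ; outer = λ dx e lt → [ inj₂ , [ inj₁ , (λ { refl → contradiction (_ , dx , e) ¬av }) ]′ ]′
                            (D-outer dx e lt) }

    module _ {l} (induced : Induced (w ∷ l)) (l⊆D : All D l) where

      -- Induction along a walk from `z` to `w`. As `z` touches nothing in `D`, its successor `z′`
      -- lies outside `D`; unless it is `w`, it has no neighbour in `D` either, or `D` would absorb
      -- it. So the walk avoids `D` and its neighbours until `w`, and `prepend` shortcuts it to an
      -- induced path.
      prolong : ∀ z z′ → z ≢ w → (∀ x → D x → ¬ Touch z x) → z ~ z′ → Conn t w z′ →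
                Σ (List V) λ A → Induced (z ∷ A ++ w ∷ l) × All (Conn t c) A
      prolong z z′ z≢w far z~z′ p with z′ ≟ w
      ... | yes refl = [] , z~z′ ∷⟨ All.map (far _) l⊆D ⟩ induced , []
      prolong z z′ z≢w far z~z′ (start _) | no z′≢w = contradiction refl z′≢w
      prolong z z′ z≢w far z~z′ (_▻⟨_⟩_ {z″} p e r) | no z′≢w
        with prolong z′ z″ z′≢w far′ (~-sym e) p
        where
        far′ : ∀ x → D x → ¬ Touch z′ x
        far′ x dx (inj₁ refl) = far x dx (inj₂ z~z′)
        far′ x dx (inj₂ z′~x) = far z′ (D-absorbs r z′≢w dx (~-sym z′~x)) (inj₂ z~z′)
      ... | A , ind , A⊆C
        with prepend z (z′ ∷ A) w l z≢w (All.map (far _) l⊆D) (here (inj₂ z~z′)) ind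
      ... | A′ , ind′ , A′⊆ =
        A′ , ind′ , All.anti-mono A′⊆ (conn-trans cw (p ▻⟨ e ⟩ r) ∷ A⊆C)

    -- The path from `u` is kept. The path from `w` is continued back to `v`, which turns `w` from
    -- an uncounted end into a counted vertex; this one extra vertex pays for the doubling.
    descend : ∀ {m m′} → ¬ Adjacent t′ d v → m ≤ suc (2 * m′) →
              TwoPaths t′ u w d m′ → TwoPaths t u v c m
    descend {m} {m′} ¬av m≤ r with attached⇒adjacent (attached-sym s)
    ... | x , cx , x~v with prolong induced₂ inside₂ v x v≢w far (~-sym x~v) (conn-trans (conn-sym cw) cx)
      where
      open TwoPaths r
      v≢w : v ≢ w
      v≢w refl = <⇒≱ v<t t≤w
      far : ∀ x → D x → ¬ Touch v x
      far x dx (inj₁ refl) = <⇒≱ v<t (conn-rank (D⊆C dx))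
      far x dx (inj₂ v~x)  = ¬av (x , dx , ~-sym v~x)
    ... | A , ind , A⊆C = record
      { induced₁ = induced₁
      ; induced₂ = ind
      ; inside₁  = All.map D⊆C inside₁
      ; inside₂  = All.++⁺ A⊆C (cw ∷ All.map D⊆C inside₂)
      ; size     = grow }
      where
      open TwoPaths r
      open ≤-Reasoning
      double : ∀ k → 2 + 2 * k ≡ 2 * suc k
      double = solve-∀
      grow : 2 * suc m ≤ 2 ^ (length l₁ + length (A ++ w ∷ l₂))
      grow = begin
        2 * suc m                                    ≤⟨ *-monoʳ-≤ 2 (s≤s m≤) ⟩
        2 * (2 + 2 * m′)                             ≡⟨ cong (2 *_) (double m′) ⟩
        2 * (2 * suc m′)                             ≤⟨ *-monoʳ-≤ 2 size ⟩
        2 ^ suc (length l₁ + length l₂)              ≡⟨ cong (2 ^_) (+-suc (length l₁) (length l₂)) ⟨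
        2 ^ (length l₁ + suc (length l₂))
          ≤⟨ ^-monoʳ-≤ 2 (+-monoʳ-≤ (length l₁) (m≤n+m (suc (length l₂)) (length A))) ⟩
        2 ^ (length l₁ + (length A + suc (length l₂))) ≡⟨ cong (λ k → 2 ^ (length l₁ + k)) (length-++ A) ⟨
        2 ^ (length l₁ + length (A ++ w ∷ l₂))       ∎

  -- The recursion and the resulting bound

  path-connected : ∀ {t x xs} → Linked _~_ (x ∷ xs) → All (λ y → t ≤ rank y) (x ∷ xs) →
                   All (Conn t x) (x ∷ xs)
  path-connected [-]      (r ∷ [])      = start r ∷ []
  path-connected (e ∷ es) (r ∷ r′ ∷ rs) =
    start r ∷ All.map (conn-trans (start r ▻⟨ e ⟩ r′)) (path-connected es (r′ ∷ rs))

  -- The threshold rises at each call, and `k` bounds how far it still can. It cannot be 0, because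
  -- `c` has rank at least `t` and below `bound`.
  twoPaths : ∀ k {t u v c} → bound ≤ t + k → Attached t u v c →
             ∀ Q → Linked _~_ Q → Unique Q → All (Conn t c) Q → TwoPaths t u v c (length Q)
  twoPaths zero {t} {c = c} le s Q _ _ _ = contradiction
    (≤-trans le (≤-trans (≤-reflexive (+-identityʳ t)) (Attached.t≤c s))) (<⇒≱ (rank<bound c))
  twoPaths (suc k) {t} {u} {v} {c} le s Q lQ uQ Q⊆C
    with minimal (connected? t c) c (start (Attached.t≤c s))
  ... | w , cw , w-min with halfWithout _~_ w Q lQ uQ
  ...   | [] , _ , _ , _ , _ , half = twoPaths-base s half
  -- The shortened path avoids `w`, so it lies in a single component, that of its first vertex `d`.
  ...   | d ∷ Q′ , lQ′ , uQ′ , w∉ , Q′⊆Q , half = go (adjacent? D.t′ d v) (adjacent? D.t′ d u)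
    where
    cd : Conn t c d
    cd = All.lookup Q⊆C (Q′⊆Q (here refl))
    d≢w : d ≢ w
    d≢w refl = w∉ (here refl)
    module D = Descend s cw w-min cd d≢w
    module D° = Descend (attached-sym s) cw w-min cd d≢w
    Q′⊆D : All (Conn D.t′ d) (d ∷ Q′)
    Q′⊆D = path-connected lQ′ (All.tabulate λ y∈ →
      D.above (All.lookup Q⊆C (Q′⊆Q y∈)) λ { refl → w∉ y∈ })
    le′ : bound ≤ D.t′ + k
    le′ = ≤-trans le (≤-trans (≤-reflexive (+-suc t k)) (s≤s (+-monoˡ-≤ k (conn-rank cw))))
    rec : ∀ {u′} → Attached D.t′ u′ w d → TwoPaths D.t′ u′ w d (length (d ∷ Q′))
    rec s′ = twoPaths k le′ s′ (d ∷ Q′) lQ′ uQ′ Q′⊆D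
    go : Dec (Adjacent D.t′ d v) → Dec (Adjacent D.t′ d u) → TwoPaths t u v c (length Q)
    go (no ¬av) _        = D.descend ¬av half (rec (D.D-attached ¬av))
    -- The mirror case: the roles of `u` and `v` are exchanged, while `w` and `D` stay the same.
    go (yes av) (no ¬au) = twoPaths-sym (D°.descend ¬au half (rec (D°.D-attached ¬au)))
    go (yes av) (yes au) = contradiction (au , av) D.¬D-adjacent-both

  -- Let `u` and `v` be the first two vertices in the order. Removing both from the path leaves a
  -- piece in one component of the rest, whose outer neighbours can only be `u` and `v`. The longer
  -- of the two resulting paths is taken.
  longInducedPath : ∀ Q → Linked _~_ Q → Unique Q → 4 ≤ length Q →
                    Σ ℕ λ s → HasInducedPathOfSize G s × (length Q ∸ 3 ≤ 2 ^ (2 * s))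
  longInducedPath Q@(q₀ ∷ q₁ ∷ _) lQ uQ@((q₀≢q₁ ∷ _) ∷ _) 4≤Q
    with minimal {λ _ → ⊤} (λ _ → yes tt) q₀ tt
  ... | u , _ , u-min with minimal (λ x → ¬? (x ≟ u)) (proj₁ other) (proj₂ other)
    where
    other : ∃ λ x → x ≢ u
    other with q₀ ≟ u
    ... | yes refl = q₁ , q₀≢q₁ ∘ ≡.sym
    ... | no q₀≢u  = q₀ , q₀≢u
  ... | v , v≢u , v-min with halfWithout _~_ u Q lQ uQ
  ... | Q₁ , lQ₁ , uQ₁ , u∉ , _ , half₁ with halfWithout _~_ v Q₁ lQ₁ uQ₁
  -- Two halvings down to the empty path would give `length Q` at most 1 + 2 * (1 + 2 * 0) = 3.
  ... | [] , _ , _ , _ , _ , half₂ =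
    contradiction (≤-trans 4≤Q (≤-trans half₁ (s≤s (*-monoʳ-≤ 2 half₂)))) 1+n≰n
  ... | Q₂@(c ∷ Q′) , lQ₂ , uQ₂ , v∉ , Q₂⊆Q₁ , half₂ =
    -- The successor counts the end `u` or `v`.
    suc s , inducedPath , ≤-trans bounded (^-monoʳ-≤ 2 sizes)
    where
    t : ℕ
    t = suc (rank v)
    above : ∀ {y} → y ≢ u → y ≢ v → t ≤ rank y
    above y≢u y≢v = ≤∧≢⇒< (v-min _ y≢u) (y≢v ∘ ≡.sym ∘ rank-injective)
    high : All (λ y → t ≤ rank y) Q₂
    high = All.tabulate λ y∈ → above (λ { refl → u∉ (Q₂⊆Q₁ y∈) }) (λ { refl → v∉ y∈ })
    low : ∀ {y} → rank y < t → y ≡ u ⊎ y ≡ v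
    low {y} lt with y ≟ u | y ≟ v
    ... | yes y≡u | _       = inj₁ y≡u
    ... | no _    | yes y≡v = inj₂ y≡v
    ... | no y≢u  | no y≢v  = contradiction (above y≢u y≢v) (<⇒≱ lt)
    attached : Attached t u v c
    attached = record
      { u≢v = v≢u ∘ ≡.sym ; u<t = s≤s (u-min v tt) ; v<t = ≤-refl
      ; t≤c = All.head high ; outer = λ _ _ → low }
    open TwoPaths (twoPaths bound (m≤n+m bound t) attached Q₂ lQ₂ uQ₂ (path-connected lQ₂ high))
    s : ℕ
    s = length l₁ ⊔ length l₂
    inducedPath : HasInducedPathOfSize G (suc s)
    inducedPath with ≤-total (length l₁) (length l₂)
    ... | inj₁ le rewrite m≤n⇒m⊔n≡n le = Induced⇒HasInducedPath induced₂
    ... | inj₂ ge rewrite m≥n⇒m⊔n≡m ge = Induced⇒HasInducedPath induced₁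
    bounded : length Q ∸ 3 ≤ 2 ^ suc (length l₁ + length l₂)
    bounded = begin
      length Q ∸ 3                                ≤⟨ ∸-monoˡ-≤ 3 half₁ ⟩
      suc (2 * length Q₁) ∸ 3                     ≤⟨ ∸-monoˡ-≤ 3 (s≤s (*-monoʳ-≤ 2 half₂)) ⟩
      suc (2 * suc (2 * length Q₂)) ∸ 3           ≡⟨ cong (_∸ 3) (expand (length Q₂)) ⟩
      2 * (2 * length Q₂)                         ≤⟨ *-monoʳ-≤ 2 (*-monoʳ-≤ 2 (n≤1+n (length Q₂))) ⟩
      2 * (2 * suc (length Q₂))                   ≤⟨ *-monoʳ-≤ 2 size ⟩
      2 ^ suc (length l₁ + length l₂)             ∎
      where
      open ≤-Reasoning
      expand : ∀ m → suc (2 * suc (2 * m)) ≡ 3 + 2 * (2 * m)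
      expand = solve-∀
    sizes : suc (length l₁ + length l₂) ≤ 2 * suc s
    sizes = begin
      suc (length l₁ + length l₂)   ≤⟨ s≤s (+-mono-≤ (m≤m⊔n (length l₁) _) (m≤n⊔m (length l₁) _)) ⟩
      suc (s + s)                   ≤⟨ n≤1+n _ ⟩
      2 + (s + s)                   ≡⟨ expand s ⟩
      2 * suc s                     ∎
      where
      open ≤-Reasoning
      expand : ∀ m → 2 + (m + m) ≡ 2 * suc m
      expand = solve-∀
  longInducedPath []       _ _ ()
  longInducedPath (_ ∷ []) _ _ (s≤s ())

-- Application to 2-connected partial 2-trees

twoConnected⇒unseparated : ∀ {N} (G : Graph N) → IsTwoConnected G →
  ∀ w {a b} → a ≢ w → b ≢ w → (S : Fin N → Set) →
  (∀ {x y} → S x → G ∶ x ~ y → y ≢ w → S y) → S a → S b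
twoConnected⇒unseparated {suc N} G (_ , _ , conn) w {a} {b} a≢w b≢w S closed Sa
  with punchView w a | punchView w b
... | hole    | _       = contradiction refl a≢w
... | _       | hole    = contradiction refl b≢w
... | punch i | punch j = along (conn w i j)
  where
  along : ∀ {j} → Reach (delete G w) i j → S (punchIn w j)
  along here                 = Sa
  -- Walks in `delete G w` never meet `w`, so `S` is closed along them.
  along (step {x = x} r e) = closed (along r) e (punchInᵢ≢i w x)

theorem5 : ∀ {N} (G : Graph N) → IsTwoConnected G → IsPartialKTree 2 G →
    (n : ℕ) → 4 ≤ n → HasPathOfSize G n →
    Σ ℕ λ s → HasInducedPathOfSize G s × (n ∸ 3 ≤ 2 ^ (2 * s))
theorem5 G 2conn (M , H , 2tree , f , f-inj , f-edge) n 4≤n (p , p-inj , p-edge) =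
  subst (λ m → Σ ℕ λ s → HasInducedPathOfSize G s × (m ∸ 3 ≤ 2 ^ (2 * s))) (length-tabulate p)
    (longInducedPath (tabulate p) (tabulate-linked p p-edge) (tabulate⁺ p-inj)
      (≤-trans 4≤n (≤-reflexive (≡.sym (length-tabulate p)))))
  where
  open Components G
    (λ {x} {y} e → ≡.trans (sym H (f y) (f x)) e)
    (λ {x} {y} → f-edge x y)
    (pullback f f-inj (eliminationOrder 2tree))
    (twoConnected⇒unseparated G 2conn)
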